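{- Let $(F_n)_{n\ge 0}$ and $(L_n)_{n\ge 0}$ be the Fibonacci and Lucas sequences. Let $2\le b\le 10$ be an integer. Then the only tuples $(n,m,k,b,d)$ of non-negative integers $n,k$ and positive integers $m$ satisfying \[ L_n = F_m\cdot b^d + L_k, \] where $d$ is the number of digits of $L_k$ in base $b$, are the following: \begin{itemize} \item $b=2$: $(2,1,1,2,1)$, $(2,2,1,2,1)$, $(4,1,2,2,2)$, $(4,2,2,2,2)$, $(4,4,1,2,1)$, $(5,3,2,2,2)$, $(5,5,1,2,1)$, $(8,5,4,2,3)$; \item $b=3$: $(3,1,1,3,1)$, $(3,2,1,3,1)$, $(4,3,1,3,1)$, $(5,4,0,3,1)$, $(9,6,3,3,2)$; \item $b=4$: $(4,1,2,4,1)$, $(4,2,2,4,1)$, $(5,3,2,4,1)$; \item $b=5$: $(4,1,0,5,1)$, $(4,2,0,5,1)$, $(5,3,1,5,1)$, $(6,4,2,5,1)$, $(7,5,3,5,1)$; \item $b=6$: $(4,1,1,6,1)$, $(4,2,1,6,1)$, $(8,1,5,6,2)$, $(8,2,5,6,2)$; \item $b=7$: $(5,1,3,7,1)$, $(5,2,3,7,1)$, $(6,3,3,7,1)$; \item $b=8$: $(5,1,2,8,1)$, $(5,2,2,8,1)$, $(6,3,0,8,1)$, $(8,5,4,8,1)$, $(14,7,5,8,2)$; \item $b=9$: $(5,1,0,9,1)$, $(5,2,0,9,1)$, $(7,4,0,9,1)$, $(8,5,0,9,1)$, $(9,6,3,9,1)$; \item $b=10$: $(5,1,1,10,1)$, $(5,2,1,10,1)$.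 \end{itemize} In particular, for $b=10$ the only Lucas number arising is $L_5=10\cdot F_1+L_1=10\cdot F_2+L_1=11$.
   Context: $F_0=0$, $F_1=1$, $F_{n+2}=F_{n+1}+F_n$; $L_0=2$, $L_1=1$, $L_{n+2}=L_{n+1}+L_n$. For a positive integer $N$, its number of digits in base $b$ is $d=\lfloor \log_b N\rfloor+1$. -}

module Defs where

open import Data.Nat using (ℕ; zero; suc; _+_; _*_; _^_; _≤_; _<_)
open import Data.Product using (_×_; _,_)
open import Data.List using (List; []; _∷_)

F : ℕ → ℕ
F zero = 0
F (suc zero) = 1
F (suc (suc n)) = F (suc n) + F n

L : ℕ → ℕ
L zero = 2
L (suc zero) = 1
L (suc (suc n)) = L (suc n) + L n

data NumDigits (b N : ℕ) : ℕ → Set where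
  digits : ∀ e → b ^ e ≤ N → N < b ^ suc e → NumDigits b N (suc e)

-- tuples (n , m , k , b , d)
Tuple : Set
Tuple = ℕ × ℕ × ℕ × ℕ × ℕ

solutions : List Tuple
solutions =
  (2 , 1 , 1 , 2 , 1) ∷ (2 , 2 , 1 , 2 , 1) ∷ (4 , 1 , 2 , 2 , 2) ∷ (4 , 2 , 2 , 2 , 2) ∷
  (4 , 4 , 1 , 2 , 1) ∷ (5 , 3 , 2 , 2 , 2) ∷ (5 , 5 , 1 , 2 , 1) ∷ (8 , 5 , 4 , 2 , 3) ∷
  (3 , 1 , 1 , 3 , 1) ∷ (3 , 2 , 1 , 3 , 1) ∷ (4 , 3 , 1 , 3 , 1) ∷ (5 , 4 , 0 , 3 , 1) ∷
  (9 , 6 , 3 , 3 , 2) ∷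
  (4 , 1 , 2 , 4 , 1) ∷ (4 , 2 , 2 , 4 , 1) ∷ (5 , 3 , 2 , 4 , 1) ∷
  (4 , 1 , 0 , 5 , 1) ∷ (4 , 2 , 0 , 5 , 1) ∷ (5 , 3 , 1 , 5 , 1) ∷ (6 , 4 , 2 , 5 , 1) ∷
  (7 , 5 , 3 , 5 , 1) ∷
  (4 , 1 , 1 , 6 , 1) ∷ (4 , 2 , 1 , 6 , 1) ∷ (8 , 1 , 5 , 6 , 2) ∷ (8 , 2 , 5 , 6 , 2) ∷
  (5 , 1 , 3 , 7 , 1) ∷ (5 , 2 , 3 , 7 , 1) ∷ (6 , 3 , 3 , 7 , 1) ∷
  (5 , 1 , 2 , 8 , 1) ∷ (5 , 2 , 2 , 8 , 1) ∷ (6 , 3 , 0 , 8 , 1) ∷ (8 , 5 , 4 , 8 , 1) ∷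
  (14 , 7 , 5 , 8 , 2) ∷
  (5 , 1 , 0 , 9 , 1) ∷ (5 , 2 , 0 , 9 , 1) ∷ (7 , 4 , 0 , 9 , 1) ∷ (8 , 5 , 0 , 9 , 1) ∷
  (9 , 6 , 3 , 9 , 1) ∷
  (5 , 1 , 1 , 10 , 1) ∷ (5 , 2 , 1 , 10 , 1) ∷ []

{-# OPTIONS --safe #-}
-- Since L k < bᵈ ≤ 10 L k, comparing sizes gives n = k + m + j with −1 ≤ j ≤ 3 once k ≥ 5.  For fixed
-- j the equation L (k + m + j) = F m · bᵈ + L k, with d above a small bound but k and m otherwise
-- unrestricted, is already unsolvable by congruences: modulo powers of the primes dividing b, and modulo
-- primes for which the Pisano period and the order of b are smooth, all residue classes of (k , m , d)
-- get excluded.  The one obstruction is j = 0 with m even, because m = 0 is then a solution for every d.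
-- There, with m = 2v, the difference L (k + 2v) − L k is 5 F v · F (k + v) or L v · L (k + v), according
-- to the parity of v, while F (2v) = F v · L v; after cancelling the common factor congruences work again.
-- For small d there are finitely many k, and for fixed n − m the difference L n − F m · bᵈ is a
-- Fibonacci-type sequence in m, which takes the value L k only for small m.
module Submission where

open import Defs
open import Data.Bool using (Bool; true; false; T; not; _∧_; _∨_)
open import Data.Bool.ListAction using (all)
open import Data.Bool.Properties using (T-≡; T-∧; T-∨)
open import Data.Empty using (⊥; ⊥-elim)
open import Data.List using (List; []; _∷_; upTo; map)
open import Data.List.Membership.Propositional using (_∈_)
open import Data.List.Membership.Propositional.Properties using (∈-upTo⁺)
import Data.List.Membership.DecPropositional as DecMembership
open import Data.List.Relation.Unary.All using (lookup)
open import Data.List.Relation.Unary.All.Properties using (all⁺)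
open import Data.List.Relation.Unary.Any using (here; there)
open import Data.Nat
open import Data.Nat.DivMod
open import Data.Nat.Properties
open import Data.Nat.Tactic.RingSolver using (solve-∀)
open import Data.Product using (∃; _×_; _,_; proj₁; proj₂)
open import Data.Product.Properties using (≡-dec)
open import Data.Sum using (inj₁; inj₂)
open import Data.Unit using (tt)
open import Function using (_∘_; _⇔_; mk⇔; Equivalence)
open import Relation.Nullary using (¬_; yes; no)
open import Relation.Nullary.Decidable using (⌊_⌋; toWitness)
open import Relation.Binary.PropositionalEquality
  using (_≡_; refl; sym; trans; cong; cong₂; subst; module ≡-Reasoning)
open Equivalence using (to; from)

-- A congruence sieve for a(y) bᴰ⁺ᶻ + b(x) = c(x + y) with Fibonacci-type sequences a, b, c

-- The recursion moves the pair of initial terms, so evaluation is linear in the index and shifting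
-- the index amounts to changing the initial terms.
G : ℕ → ℕ → ℕ → ℕ
G a c zero    = a
G a c (suc n) = G c (a + c) n

G-rec : ∀ a c n → G a c (2 + n) ≡ G a c n + G a c (1 + n)
G-rec a c zero    = refl
G-rec a c (suc n) = G-rec c (a + c) n

G-shift : ∀ a c m n → G a c (m + n) ≡ G (G a c m) (G a c (suc m)) n
G-shift a c zero    n = refl
G-shift a c (suc m) n = G-shift c (a + c) m n

module Congruence (q : ℕ) .{{_ : NonZero q}} where

  infix 4 _≈_
  _≈_ : ℕ → ℕ → Set
  m ≈ n = m % q ≡ n % q

  +-cong : ∀ {k l m n} → k ≈ l → m ≈ n → k + m ≈ l + n
  +-cong {k} {l} {m} {n} k≈l m≈n = begin
    (k + m) % q              ≡⟨ %-distribˡ-+ k m q ⟩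
    (k % q + m % q) % q      ≡⟨ cong₂ (λ s t → (s + t) % q) k≈l m≈n ⟩
    (l % q + n % q) % q      ≡⟨ %-distribˡ-+ l n q ⟨
    (l + n) % q              ∎
    where open ≡-Reasoning

  *-cong : ∀ {k l m n} → k ≈ l → m ≈ n → k * m ≈ l * n
  *-cong {k} {l} {m} {n} k≈l m≈n = begin
    (k * m) % q              ≡⟨ %-distribˡ-* k m q ⟩
    (k % q * (m % q)) % q    ≡⟨ cong₂ (λ s t → (s * t) % q) k≈l m≈n ⟩
    (l % q * (n % q)) % q    ≡⟨ %-distribˡ-* l n q ⟨
    (l * n) % q              ∎
    where open ≡-Reasoning

  G-cong : ∀ {a a′ c c′} n → a ≈ a′ → c ≈ c′ → G a c n ≈ G a′ c′ n
  G-cong zero    a≈a′ c≈c′ = a≈a′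
  G-cong {a} {a′} {c} {c′} (suc n) a≈a′ c≈c′ =
    G-cong n c≈c′ (+-cong {a} {a′} {c} {c′} a≈a′ c≈c′)

  -- Two consecutive terms determine all later ones, so a single return of the initial pair modulo
  -- `q` forces periodicity.
  G-periodic : ∀ a c p → G a c p ≈ a → G a c (suc p) ≈ c → ∀ n → G a c (p + n) ≈ G a c n
  G-periodic a c p Gp≈a Gp+1≈c n = trans (cong (_% q) (G-shift a c p n)) (G-cong n Gp≈a Gp+1≈c)

  -- If `b` and `q` have a common factor, the powers of `b` are only eventually periodic modulo `q`;
  -- `D` leaves room for the preperiod.
  ^-periodic : ∀ b D o → b ^ (D + o) ≈ b ^ D → ∀ n → b ^ (D + (o + n)) ≈ b ^ (D + n)
  ^-periodic b D o bᴰ⁺ᵒ≈bᴰ n = begin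
    (b ^ (D + (o + n))) % q    ≡⟨ cong (λ e → b ^ e % q) (sym (+-assoc D o n)) ⟩
    (b ^ (D + o + n)) % q      ≡⟨ cong (_% q) (^-distribˡ-+-* b (D + o) n) ⟩
    (b ^ (D + o) * b ^ n) % q  ≡⟨ *-cong {b ^ (D + o)} {b ^ D} {b ^ n} bᴰ⁺ᵒ≈bᴰ refl ⟩
    (b ^ D * b ^ n) % q        ≡⟨ cong (_% q) (^-distribˡ-+-* b D n) ⟨
    (b ^ (D + n)) % q          ∎
    where open ≡-Reasoning

  module _ (f : ℕ → ℕ) (p : ℕ) .{{_ : NonZero p}} (periodic : ∀ n → f (p + n) ≈ f n) where

    periodic-* : ∀ t n → f (n + t * p) ≈ f n
    periodic-* zero    n = cong (λ m → f m % q) (+-identityʳ n)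
    periodic-* (suc t) n = trans (cong (λ m → f m % q) (rearrange n p (t * p)))
                                 (trans (periodic (n + t * p)) (periodic-* t n))
      where
      rearrange : ∀ n p m → n + (p + m) ≡ p + (n + m)
      rearrange = solve-∀

    periodic-% : ∀ n → f (n % p) ≈ f n
    periodic-% n = trans (sym (periodic-* (n / p) (n % p)))
                         (cong (λ m → f m % q) (sym (m≡m%n+[m/n]*n n p)))

nth : List ℕ → ℕ → ℕ
-- The sieve never reaches this default: it reduces each index modulo the length of the table.
nth []       n       = 0
nth (x ∷ xs) zero    = x
nth (x ∷ xs) (suc n) = nth xs n

module Tables (q : ℕ) .{{_ : NonZero q}} where
  open Congruence q

  G-table : ℕ → ℕ → ℕ → List ℕ
  G-table a c zero    = []
  G-table a c (suc n) = a ∷ G-table c ((a + c) % q) n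

  -- Only a congruence, because the first two entries are stored as given, while later ones are
  -- reduced at once to keep the numbers small.
  nth-G-table : ∀ a c {n i} → i < n → nth (G-table a c n) i ≈ G a c i
  nth-G-table a c {suc n} {zero}  _       = refl
  nth-G-table a c {suc n} {suc i} (s≤s l) =
    trans (nth-G-table c ((a + c) % q) l) (G-cong i (refl {x = c % q}) (m%n%n≡m%n (a + c) q))

  power-table : ℕ → ℕ → ℕ → List ℕ
  power-table b x zero    = []
  power-table b x (suc n) = x ∷ power-table b ((x * b) % q) n

  nth-power-table : ∀ b x {n i} → i < n → nth (power-table b x n) i ≈ x * b ^ i
  nth-power-table b x {suc n} {zero}  _       = cong (_% q) (sym (*-identityʳ x))
  nth-power-table b x {suc n} {suc i} (s≤s l) = begin
    nth (power-table b ((x * b) % q) n) i % q  ≡⟨ nth-power-table b ((x * b) % q) l ⟩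
    ((x * b) % q * b ^ i) % q                  ≡⟨ *-cong {(x * b) % q} {x * b} {b ^ i} (m%n%n≡m%n (x * b) q) refl ⟩
    (x * b * b ^ i) % q                        ≡⟨ cong (_% q) (*-assoc x b (b ^ i)) ⟩
    (x * (b * b ^ i)) % q                      ∎
    where open ≡-Reasoning

-- One shape for every equation put to the sieve: each sequence is given by its first two terms, and
-- `offset` is the lower bound on the exponent.
record Equation : Set where
  constructor eqn
  field
    base offset       : ℕ
    a₀ a₁ b₀ b₁ c₀ c₁ : ℕ

  Holds : ℕ → ℕ → ℕ → Set
  Holds x y z = G a₀ a₁ y * base ^ (offset + z) + G b₀ b₁ x ≡ G c₀ c₁ (x + y)

-- The equation is tested modulo `modulus`: there every G a c occurring in it has period `period`, and
-- base ^ (offset + z) has period `order` in z.  Before the test the moduli of the residue classes of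
-- x and y are multiplied by `growth₁`, that of z by `growth₂`.
record Step : Set where
  constructor step
  field
    modulus period order growth₁ growth₂ : ℕ
    .{{modulus≢0}} : NonZero modulus
    .{{period≢0}}  : NonZero period
    .{{order≢0}}   : NonZero order
    .{{growth₁≢0}} : NonZero growth₁
    .{{growth₂≢0}} : NonZero growth₂

-- Refutation by successive refinement of residue classes

record Filter : Set where
  constructor filter
  field
    growth₁ growth₂ : ℕ
    .{{growth₁≢0}} : NonZero growth₁
    .{{growth₂≢0}} : NonZero growth₂
    passes : ℕ → ℕ → ℕ → Bool

-- A depth-first search, in which `P` is the modulus of the current classes of `x` and `y`, and `O`
-- that of the class of `z`.
refute : List Filter → (P O x y z : ℕ) → Bool
branch : Filter → List Filter → (P O x y z : ℕ) → Bool

-- A class left over when the filters are exhausted might contain a solution, so the search fails.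
refute []       P O x y z = false
refute (φ ∷ φs) P O x y z =
  all (λ i → all (λ j → all (λ l → branch φ φs (c * P) (e * O) (x + i * P) (y + j * P) (z + l * O))
    (upTo e)) (upTo c)) (upTo c)
  where open Filter φ renaming (growth₁ to c; growth₂ to e)

branch φ φs P O x y z = not (Filter.passes φ x y z) ∨ refute φs P O x y z

T-all-upTo : ∀ {f n} → T (all f (upTo n)) → ∀ {i} → i < n → T (f i)
T-all-upTo {f} {n} h i<n = lookup (all⁺ f (upTo n) h) (∈-upTo⁺ i<n)

infix 4 _∈_+ℕ·_
record _∈_+ℕ·_ (X x P : ℕ) : Set where
  constructor multiple
  field
    t     : ℕ
    X≡x+t : X ≡ x + t * P

-- The residue of the quotient `t` modulo `c` selects the subclass that contains `X`.
∈-refine : ∀ {X x P} c .{{_ : NonZero c}} (X∈ : X ∈ x +ℕ· P) →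
           X ∈ x + _∈_+ℕ·_.t X∈ % c * P +ℕ· c * P
∈-refine {x = x} {P} c (multiple t refl) = multiple (t / c) (begin
  x + t * P                        ≡⟨ cong (λ s → x + s * P) (m≡m%n+[m/n]*n t c) ⟩
  x + (t % c + t / c * c) * P      ≡⟨ distribute x (t % c) (t / c) c P ⟩
  x + t % c * P + t / c * (c * P)  ∎)
  where
  open ≡-Reasoning
  distribute : ∀ x r s c P → x + (r + s * c) * P ≡ x + r * P + s * (c * P)
  distribute = solve-∀

module Soundness (E : Equation) where
  open Equation E

  Sound : ℕ → ℕ → Filter → Set
  Sound P O φ = ∀ {X Y Z x y z} → X ∈ x +ℕ· P → Y ∈ y +ℕ· P → Z ∈ z +ℕ· O →
                Holds X Y Z → T (Filter.passes φ x y z)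

  data AllSound (P O : ℕ) : List Filter → Set where
    []  : AllSound P O []
    _∷_ : ∀ {φ φs} → Sound (Filter.growth₁ φ * P) (Filter.growth₂ φ * O) φ →
          AllSound (Filter.growth₁ φ * P) (Filter.growth₂ φ * O) φs → AllSound P O (φ ∷ φs)

  -- Follow the branch of classes containing a supposed solution: it passes every sound filter, so
  -- the search must go on below it, until the empty list refutes nothing.
  refute-sound : ∀ {P O φs X Y Z x y z} → AllSound P O φs → T (refute φs P O x y z) →
                 X ∈ x +ℕ· P → Y ∈ y +ℕ· P → Z ∈ z +ℕ· O → ¬ Holds X Y Z
  refute-sound {φs = φ ∷ φs} {x = x} {y} {z} (s ∷ ss) ref X∈ Y∈ Z∈ holds
    with to (T-∨ {not (Filter.passes φ _ _ _)})
            (T-all-upTo (T-all-upTo (T-all-upTo ref (m%n<n (t X∈) c)) (m%n<n (t Y∈) c)) (m%n<n (t Z∈) e))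
    where
    open Filter φ renaming (growth₁ to c; growth₂ to e)
    open _∈_+ℕ·_
  ... | inj₁ fails = T-not⇒¬T fails (s (∈-refine _ X∈) (∈-refine _ Y∈) (∈-refine _ Z∈) holds)
    where
    T-not⇒¬T : ∀ {b} → T (not b) → ¬ T b
    T-not⇒¬T {false} _ ()
  ... | inj₂ ref′ = refute-sound ss ref′ (∈-refine _ X∈) (∈-refine _ Y∈) (∈-refine _ Z∈) holds

module Sieve (E : Equation) where
  open Equation E
  open Soundness E

  -- The tables are arguments, so that evaluation can share them among all residue classes.
  passesWith : (q p o : ℕ) .{{_ : NonZero q}} .{{_ : NonZero p}} .{{_ : NonZero o}} →
               (as bs cs hs : List ℕ) → ℕ → ℕ → ℕ → Bool
  passesWith q p o as bs cs hs x y z =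
    (nth as (y % p) * nth hs (z % o) + nth bs (x % p)) % q ≡ᵇ nth cs ((x + y) % p) % q

  toFilter : Step → Filter
  toFilter (step q p o c e) = filter c e
    (passesWith q p o (G-table a₀ a₁ p) (G-table b₀ b₁ p) (G-table c₀ c₁ p)
                      (power-table base (base ^ offset % q) o))
    where open Tables q

  periodicᵇ : (q p : ℕ) .{{_ : NonZero q}} → ℕ → ℕ → Bool
  periodicᵇ q p a c = (G a c p % q ≡ᵇ a % q) ∧ (G a c (suc p) % q ≡ᵇ c % q)

  -- Divisibility of the running moduli by `p` and `o` makes the verdict of a filter depend on the
  -- residue classes alone.
  valid : List Step → ℕ → ℕ → Bool
  valid []                       P O = true
  valid (step q p o c e ∷ steps) P O =
    ((c * P) % p ≡ᵇ 0) ∧ ((e * O) % o ≡ᵇ 0) ∧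
    periodicᵇ q p a₀ a₁ ∧ periodicᵇ q p b₀ b₁ ∧ periodicᵇ q p c₀ c₁ ∧
    (base ^ (offset + o) % q ≡ᵇ base ^ offset % q) ∧ valid steps (c * P) (e * O)

  ∈⇒%≡ : ∀ {X x P} p .{{_ : NonZero p}} → P % p ≡ 0 → X ∈ x +ℕ· P → X % p ≡ x % p
  ∈⇒%≡ {x = x} {P} p p∣P (multiple t refl) = begin
    (x + t * P) % p              ≡⟨ cong (λ m → (x + t * m) % p) (m≡m%n+[m/n]*n P p) ⟩
    (x + t * (P % p + s * p)) % p ≡⟨ cong (λ m → (x + t * (m + s * p)) % p) p∣P ⟩
    (x + t * (s * p)) % p        ≡⟨ cong (λ m → (x + m) % p) (sym (*-assoc t s p)) ⟩
    (x + t * s * p) % p          ≡⟨ [m+kn]%n≡m%n x (t * s) p ⟩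
    x % p                        ∎
    where
    open ≡-Reasoning
    s = P / p

  module _ {q p : ℕ} .{{_ : NonZero q}} .{{_ : NonZero p}} where
    open Congruence q
    open Tables q

    G-entry : ∀ {a c X x} → T (periodicᵇ q p a c) → X % p ≡ x % p →
              nth (G-table a c p) (x % p) ≈ G a c X
    G-entry {a} {c} {X} {x} h X≡x = begin
      nth (G-table a c p) (x % p) % q  ≡⟨ nth-G-table a c (m%n<n x p) ⟩
      G a c (x % p) % q                ≡⟨ cong (λ i → G a c i % q) X≡x ⟨
      G a c (X % p) % q                ≡⟨ periodic-% (G a c) p (G-periodic a c p h₀ h₁) X ⟩
      G a c X % q                      ∎
      where
      open ≡-Reasoning
      h₀ : G a c p ≈ a
      h₀ = ≡ᵇ⇒≡ _ _ (proj₁ (to T-∧ h))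
      h₁ : G a c (suc p) ≈ c
      h₁ = ≡ᵇ⇒≡ _ _ (proj₂ (to (T-∧ {G a c p % q ≡ᵇ a % q}) h))

    power-entry : ∀ {o Z z} .{{_ : NonZero o}} → base ^ (offset + o) ≈ base ^ offset → Z % o ≡ z % o →
                  nth (power-table base (base ^ offset % q) o) (z % o) ≈ base ^ (offset + Z)
    power-entry {o} {Z} {z} h Z≡z = begin
      nth (power-table base (base ^ offset % q) o) (z % o) % q
        ≡⟨ nth-power-table base (base ^ offset % q) (m%n<n z o) ⟩
      (base ^ offset % q * base ^ (z % o)) % q
        ≡⟨ *-cong {base ^ offset % q} {base ^ offset} {base ^ (z % o)} (m%n%n≡m%n (base ^ offset) q) refl ⟩
      (base ^ offset * base ^ (z % o)) % q
        ≡⟨ cong (_% q) (^-distribˡ-+-* base offset (z % o)) ⟨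
      base ^ (offset + z % o) % q
        ≡⟨ cong (λ i → base ^ (offset + i) % q) Z≡z ⟨
      base ^ (offset + Z % o) % q
        ≡⟨ periodic-% (λ i → base ^ (offset + i)) o (^-periodic base offset o h) Z ⟩
      base ^ (offset + Z) % q ∎
      where open ≡-Reasoning

  valid⇒sound : ∀ steps P O → T (valid steps P O) → AllSound P O (map toFilter steps)
  valid⇒sound []                       P O _ = []
  valid⇒sound (step q p o c e ∷ steps) P O h =
    let hp , h = to (T-∧ {(c * P) % p ≡ᵇ 0}) h
        ho , h = to (T-∧ {(e * O) % o ≡ᵇ 0}) h
        ha , h = to (T-∧ {periodicᵇ q p a₀ a₁}) h
        hb , h = to (T-∧ {periodicᵇ q p b₀ b₁}) h
        hc , h = to (T-∧ {periodicᵇ q p c₀ c₁}) h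
        hh , h = to (T-∧ {base ^ (offset + o) % q ≡ᵇ base ^ offset % q}) h
    in sound (≡ᵇ⇒≡ _ _ hp) (≡ᵇ⇒≡ _ _ ho) ha hb hc (≡ᵇ⇒≡ _ _ hh) ∷ valid⇒sound steps (c * P) (e * O) h
    where
    open Congruence q
    open Tables q
    sound : ∀ {P O} → P % p ≡ 0 → O % o ≡ 0 →
            T (periodicᵇ q p a₀ a₁) → T (periodicᵇ q p b₀ b₁) → T (periodicᵇ q p c₀ c₁) →
            base ^ (offset + o) ≈ base ^ offset → Sound P O (toFilter (step q p o c e))
    sound p∣P o∣O ha hb hc hh {X} {Y} {Z} {x} {y} {z} X∈ Y∈ Z∈ holds = ≡⇒≡ᵇ _ _ (begin
      (nth as (y % p) * nth hs (z % o) + nth bs (x % p)) % q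
        ≡⟨ +-cong (*-cong (G-entry {x = y} ha Y≡y) (power-entry {p = p} {z = z} hh Z≡z)) (G-entry {x = x} hb X≡x) ⟩
      (G a₀ a₁ Y * base ^ (offset + Z) + G b₀ b₁ X) % q
        ≡⟨ cong (_% q) holds ⟩
      G c₀ c₁ (X + Y) % q
        ≡⟨ G-entry {x = x + y} hc X+Y≡x+y ⟨
      nth cs ((x + y) % p) % q ∎)
      where
      open ≡-Reasoning
      as = G-table a₀ a₁ p
      bs = G-table b₀ b₁ p
      cs = G-table c₀ c₁ p
      hs = power-table base (base ^ offset % q) o
      X≡x = ∈⇒%≡ p p∣P X∈
      Y≡y = ∈⇒%≡ p p∣P Y∈
      Z≡z = ∈⇒%≡ o o∣O Z∈
      X+Y≡x+y : (X + Y) % p ≡ (x + y) % p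
      X+Y≡x+y = Congruence.+-cong p {X} {x} {Y} {y} X≡x Y≡y

  -- The parity of `y` is prescribed because some of the equations are to be refuted in one parity
  -- only.
  refuteParity : List Filter → ℕ → Bool
  refuteParity φs r = refute φs 2 1 0 r 0 ∧ refute φs 2 1 1 r 0

  excludes : List Step → ℕ → Bool
  excludes steps r = valid steps 2 1 ∧ refuteParity (map toFilter steps) r

  excludes-sound : ∀ steps r → T (excludes steps r) → ∀ x t z → ¬ Holds x (r + t * 2) z
  excludes-sound steps r h x t z =
    let hv , hr = to (T-∧ {valid steps 2 1}) h
        ss = valid⇒sound steps 2 1 hv
        h₀ , h₁ = to (T-∧ {refute (map toFilter steps) 2 1 0 r 0}) hr
        z∈ = multiple z (sym (*-identityʳ z))
        x∈ = multiple (x / 2) (m≡m%n+[m/n]*n x 2)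
    in case ss h₀ h₁ (x % 2) (m%n<n x 2) x∈ (multiple t refl) z∈
    where
    case : AllSound 2 1 (map toFilter steps) → T (refute (map toFilter steps) 2 1 0 r 0) →
           T (refute (map toFilter steps) 2 1 1 r 0) → ∀ x₀ → x₀ < 2 → x ∈ x₀ +ℕ· 2 →
           r + t * 2 ∈ r +ℕ· 2 → z ∈ 0 +ℕ· 1 → ¬ Holds x (r + t * 2) z
    case ss h₀ h₁ 0 _ = refute-sound ss h₀
    case ss h₀ h₁ 1 _ = refute-sound ss h₁
    case ss h₀ h₁ (suc (suc _)) (s≤s (s≤s ()))

-- Fibonacci and Lucas identities

Recurrent : (ℕ → ℕ) → Set
Recurrent f = ∀ n → f (2 + n) ≡ f (1 + n) + f n

Recurrent⇒G : ∀ f → Recurrent f → ∀ n → f n ≡ G (f 0) (f 1) n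
Recurrent⇒G f rec 0             = refl
Recurrent⇒G f rec 1             = refl
Recurrent⇒G f rec (suc (suc n)) = begin
  f (2 + n)                                  ≡⟨ rec n ⟩
  f (1 + n) + f n                            ≡⟨ cong₂ _+_ (Recurrent⇒G f rec (suc n)) (Recurrent⇒G f rec n) ⟩
  G (f 0) (f 1) (1 + n) + G (f 0) (f 1) n    ≡⟨ +-comm (G (f 0) (f 1) (1 + n)) _ ⟩
  G (f 0) (f 1) n + G (f 0) (f 1) (1 + n)    ≡⟨ G-rec (f 0) (f 1) n ⟨
  G (f 0) (f 1) (2 + n)                      ∎
  where open ≡-Reasoning

-- Both sides satisfy the Fibonacci recurrence in `t`; starting at `suc t` avoids the index t - 1.
Recurrent-add : ∀ f → Recurrent f → ∀ t n → f (suc t + n) ≡ F t * f n + F (suc t) * f (suc n)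
Recurrent-add f rec 0 n = sym (+-identityʳ (f (suc n)))
Recurrent-add f rec 1 n = trans (rec n) (swap (f (suc n)) (f n))
  where
  swap : ∀ x y → x + y ≡ 1 * y + 1 * x
  swap = solve-∀
Recurrent-add f rec (suc (suc t)) n = begin
  f (3 + t + n)                  ≡⟨ rec (suc t + n) ⟩
  f (2 + t + n) + f (1 + t + n)  ≡⟨ cong₂ _+_ (Recurrent-add f rec (suc t) n) (Recurrent-add f rec t n) ⟩
  F (1 + t) * f n + F (2 + t) * f (suc n) + (F t * f n + F (suc t) * f (suc n))
                                 ≡⟨ collect (F (1 + t)) (F (2 + t)) (F t) (f n) (f (suc n)) ⟩
  F (2 + t) * f n + F (3 + t) * f (suc n) ∎
  where
  open ≡-Reasoning
  collect : ∀ u v w x y → u * x + v * y + (w * x + u * y) ≡ (u + w) * x + (v + u) * y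
  collect = solve-∀

F-add : ∀ t n → F (suc t + n) ≡ F t * F n + F (suc t) * F (suc n)
F-add = Recurrent-add F (λ _ → refl)

L-add : ∀ t n → L (suc t + n) ≡ F t * L n + F (suc t) * L (suc n)
L-add = Recurrent-add L (λ _ → refl)

-- Eliminates L, so that identities between Lucas numbers become polynomial identities in Fibonacci
-- numbers.
L≡F+F : ∀ n → L (suc n) ≡ 2 * F n + F (suc n)
L≡F+F n = trans (sym (cong L (+-identityʳ (suc n)))) (trans (L-add n 0)
                (cong₂ _+_ (*-comm (F n) 2) (*-identityʳ (F (suc n)))))

F>0 : ∀ n → 0 < F (suc n)
F>0 zero    = s≤s z≤n
F>0 (suc n) = <-≤-trans (F>0 n) (m≤m+n (F (suc n)) (F n))

L>0 : ∀ n → 0 < L n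
L>0 0             = s≤s z≤n
L>0 1             = s≤s z≤n
L>0 (suc (suc n)) = <-≤-trans (L>0 (suc n)) (m≤m+n (L (suc n)) (L n))

-- Cassini's identity p² + pa - a² = ∓1 for p = F (v - 1) and a = F v, written without subtraction.
-- The parity in the name is that of v.
cassini-odd : ∀ s → F (s * 2) * F (s * 2) + F (s * 2) * F (1 + s * 2) + 1 ≡ F (1 + s * 2) * F (1 + s * 2)
cassini-odd zero    = refl
cassini-odd (suc s) = begin
  (a + p) * (a + p) + (a + p) * (a + p + a) + 1  ≡⟨ lhs p a ⟩
  (p * p + p * a + 1) + (p * p + 4 * p * a + 3 * a * a)  ≡⟨ cong (_+ (p * p + 4 * p * a + 3 * a * a)) (cassini-odd s) ⟩
  a * a + (p * p + 4 * p * a + 3 * a * a)        ≡⟨ rhs p a ⟩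
  (a + p + a) * (a + p + a)                      ∎
  where
  open ≡-Reasoning
  p = F (s * 2)
  a = F (1 + s * 2)
  lhs : ∀ p a → (a + p) * (a + p) + (a + p) * (a + p + a) + 1 ≡ (p * p + p * a + 1) + (p * p + 4 * p * a + 3 * a * a)
  lhs = solve-∀
  rhs : ∀ p a → a * a + (p * p + 4 * p * a + 3 * a * a) ≡ (a + p + a) * (a + p + a)
  rhs = solve-∀

-- Passing from (p , a) to (a , a + p) changes the sign of p² + pa - a².
cassini-even : ∀ s → F (1 + s * 2) * F (1 + s * 2) + F (1 + s * 2) * F (2 + s * 2) ≡ F (2 + s * 2) * F (2 + s * 2) + 1
cassini-even s = begin
  a * a + a * (a + p)                      ≡⟨ cong (_+ a * (a + p)) (cassini-odd s) ⟨
  p * p + p * a + 1 + a * (a + p)          ≡⟨ rearrange p a ⟩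
  (a + p) * (a + p) + 1                    ∎
  where
  open ≡-Reasoning
  p = F (s * 2)
  a = F (1 + s * 2)
  rearrange : ∀ p a → p * p + p * a + 1 + a * (a + p) ≡ (a + p) * (a + p) + 1
  rearrange = solve-∀

-- Successor indices make the preceding Fibonacci numbers available: by the addition formulas all
-- terms are polynomials in `p`, `a`, `f`, `g`, and the two sides agree up to one use of Cassini.
module Doubling (w k : ℕ) where
  private
    v = suc w
    p = F w
    a = F v
    f = F k
    g = F (suc k)
    X = F (v + k)
    Y = F (suc (v + k))

  F-double : F (v + v) ≡ F v * L v
  F-double = begin
    F (v + v)                ≡⟨ F-add w v ⟩
    p * a + a * (a + p)      ≡⟨ rearrange p a ⟩
    a * (2 * p + a)          ≡⟨ cong (a *_) (L≡F+F w) ⟨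
    a * L v                  ∎
    where
    open ≡-Reasoning
    rearrange : ∀ p a → p * a + a * (a + p) ≡ a * (2 * p + a)
    rearrange = solve-∀

  private
    X≡ : X ≡ p * f + a * g
    X≡ = F-add w k

    Y≡ : Y ≡ p * g + a * (g + f)
    Y≡ = trans (cong F (sym (+-suc v k))) (F-add w (suc k))

    L[2v+k+1] : L (v + (v + suc k)) ≡ 2 * (p * X + a * Y) + (p * Y + a * (Y + X))
    L[2v+k+1] = begin
      L (v + (v + suc k))                    ≡⟨ cong (λ n → L (v + n)) (+-suc v k) ⟩
      L (v + suc (v + k))                    ≡⟨ cong L (+-suc v (v + k)) ⟩
      L (suc (v + (v + k)))                  ≡⟨ L≡F+F (v + (v + k)) ⟩
      2 * F (v + (v + k)) + F (suc (v + (v + k)))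
        ≡⟨ cong₂ (λ s t → 2 * s + t) (F-add w (v + k))
                 (trans (cong F (sym (+-suc v (v + k)))) (F-add w (suc (v + k)))) ⟩
      2 * (p * X + a * Y) + (p * Y + a * (Y + X)) ∎
      where open ≡-Reasoning

  L-difference-even : p * p + p * a ≡ a * a + 1 → L (v + (v + suc k)) ≡ L (suc k) + F v * (5 * F (suc (v + k)))
  L-difference-even cassini = begin
    L (v + (v + suc k))                                          ≡⟨ L[2v+k+1] ⟩
    2 * (p * X + a * Y) + (p * Y + a * (Y + X))                  ≡⟨ cong₂ (λ s t → 2 * (p * s + a * t) + (p * t + a * (t + s))) X≡ Y≡ ⟩
    2 * (p * (p * f + a * g) + a * (p * g + a * (g + f))) + (p * (p * g + a * (g + f)) + a * ((p * g + a * (g + f)) + (p * f + a * g)))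
      ≡⟨ lhs p a f g ⟩
    R (p * p + p * a)                                            ≡⟨ cong R cassini ⟩
    R (a * a + 1)                                                ≡⟨ rhs p a f g ⟩
    2 * f + g + a * (5 * (p * g + a * (g + f)))                  ≡⟨ cong₂ (λ s t → s + a * (5 * t)) (L≡F+F k) Y≡ ⟨
    L (suc k) + a * (5 * Y)                                      ∎
    where
    open ≡-Reasoning
    -- `s` marks the occurrences of p² + pa that Cassini turns into a² + 1.
    R : ℕ → ℕ
    R s = 2 * f * s + g * (s + 2 * p * a + a * a) + a * (3 * (p * g + a * (g + f)))
    lhs : ∀ p a f g →
      2 * (p * (p * f + a * g) + a * (p * g + a * (g + f))) + (p * (p * g + a * (g + f)) + a * ((p * g + a * (g + f)) + (p * f + a * g))) ≡
      2 * f * (p * p + p * a) + g * ((p * p + p * a) + 2 * p * a + a * a) + a * (3 * (p * g + a * (g + f)))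
    lhs = solve-∀
    rhs : ∀ p a f g →
      2 * f * (a * a + 1) + g * ((a * a + 1) + 2 * p * a + a * a) + a * (3 * (p * g + a * (g + f))) ≡
      2 * f + g + a * (5 * (p * g + a * (g + f)))
    rhs = solve-∀

  L-difference-odd : p * p + p * a + 1 ≡ a * a → L (v + (v + suc k)) ≡ L (suc k) + L v * L (suc (v + k))
  L-difference-odd cassini = begin
    L (v + (v + suc k))                                          ≡⟨ L[2v+k+1] ⟩
    2 * (p * X + a * Y) + (p * Y + a * (Y + X))                  ≡⟨ cong₂ (λ s t → 2 * (p * s + a * t) + (p * t + a * (t + s))) X≡ Y≡ ⟩
    2 * (p * (p * f + a * g) + a * (p * g + a * (g + f))) + (p * (p * g + a * (g + f)) + a * ((p * g + a * (g + f)) + (p * f + a * g)))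
      ≡⟨ lhs p a f g ⟩
    R (a * a)                                                    ≡⟨ cong R cassini ⟨
    R (p * p + p * a + 1)                                        ≡⟨ rhs p a f g ⟩
    2 * f + g + (2 * p + a) * (2 * (p * f + a * g) + (p * g + a * (g + f)))
      ≡⟨ cong₂ (λ s t → s + (2 * p + a) * t) (L≡F+F k) (trans (L≡F+F (v + k)) (cong₂ (λ s t → 2 * s + t) X≡ Y≡)) ⟨
    L (suc k) + (2 * p + a) * L (suc (v + k))                    ≡⟨ cong (λ s → L (suc k) + s * L (suc (v + k))) (L≡F+F w) ⟨
    L (suc k) + L v * L (suc (v + k))                            ∎
    where
    open ≡-Reasoning
    -- Here `s` marks the occurrences of a² that Cassini turns into p² + pa + 1.
    R : ℕ → ℕ
    R s = 2 * f * s + g * s + (f * (2 * p * p + 2 * p * a + a * a) + g * (p * p + 6 * p * a + 3 * a * a))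
    lhs : ∀ p a f g →
      2 * (p * (p * f + a * g) + a * (p * g + a * (g + f))) + (p * (p * g + a * (g + f)) + a * ((p * g + a * (g + f)) + (p * f + a * g))) ≡
      2 * f * (a * a) + g * (a * a) + (f * (2 * p * p + 2 * p * a + a * a) + g * (p * p + 6 * p * a + 3 * a * a))
    lhs = solve-∀
    rhs : ∀ p a f g →
      2 * f * (p * p + p * a + 1) + g * (p * p + p * a + 1) + (f * (2 * p * p + 2 * p * a + a * a) + g * (p * p + 6 * p * a + 3 * a * a)) ≡
      2 * f + g + (2 * p + a) * (2 * (p * f + a * g) + (p * g + a * (g + f)))
    rhs = solve-∀

-- Unsolvability for large d

-- x = k, y = m − 1 and n = k + m − 1 + i.
shifted : (p D i : ℕ) → Equation
shifted p D i = eqn p D 1 1 2 1 (L i) (L (suc i))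

-- Here y = m/2 and n = x + 2y, and the parity in the name is that of y.
halfEven halfOdd : (p D : ℕ) → Equation
halfEven p D = eqn p D 2 1 0 0 0 5
halfOdd  p D = eqn p D 0 1 0 0 2 1

shifted-holds : ∀ p D i x y z → L (x + y + i) ≡ F (suc y) * p ^ (D + z) + L x →
                Equation.Holds (shifted p D i) x y z
shifted-holds p D i x y z eq = begin
  G 1 1 y * p ^ (D + z) + G 2 1 x   ≡⟨ cong₂ (λ s t → s * p ^ (D + z) + t)
                                         (Recurrent⇒G (F ∘ suc) (λ _ → refl) y) (Recurrent⇒G L (λ _ → refl) x) ⟨
  F (suc y) * p ^ (D + z) + L x     ≡⟨ eq ⟨
  L (x + y + i)                     ≡⟨ Recurrent⇒G (λ n → L (n + i)) (λ _ → refl) (x + y) ⟩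
  G (L i) (L (suc i)) (x + y)       ∎
  where open ≡-Reasoning

G-zero : ∀ n → G 0 0 n ≡ 0
G-zero zero    = refl
G-zero (suc n) = G-zero n

halfEven-holds : ∀ p D x y z → 5 * F (x + y) ≡ L y * p ^ (D + z) → Equation.Holds (halfEven p D) x y z
halfEven-holds p D x y z eq = begin
  G 2 1 y * p ^ (D + z) + G 0 0 x   ≡⟨ cong₂ (λ s t → s * p ^ (D + z) + t)
                                         (Recurrent⇒G L (λ _ → refl) y) (sym (G-zero x)) ⟨
  L y * p ^ (D + z) + 0             ≡⟨ +-identityʳ _ ⟩
  L y * p ^ (D + z)                 ≡⟨ eq ⟨
  5 * F (x + y)                     ≡⟨ Recurrent⇒G (λ n → 5 * F n) (λ n → *-distribˡ-+ 5 (F (suc n)) (F n)) (x + y) ⟩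
  G 0 5 (x + y)                     ∎
  where open ≡-Reasoning

halfOdd-holds : ∀ p D x y z → L (x + y) ≡ F y * p ^ (D + z) → Equation.Holds (halfOdd p D) x y z
halfOdd-holds p D x y z eq = begin
  G 0 1 y * p ^ (D + z) + G 0 0 x   ≡⟨ cong₂ (λ s t → s * p ^ (D + z) + t)
                                         (Recurrent⇒G F (λ _ → refl) y) (sym (G-zero x)) ⟨
  F y * p ^ (D + z) + 0             ≡⟨ +-identityʳ _ ⟩
  F y * p ^ (D + z)                 ≡⟨ eq ⟨
  L (x + y)                         ≡⟨ Recurrent⇒G L (λ _ → refl) (x + y) ⟩
  G 2 1 (x + y)                     ∎
  where open ≡-Reasoning

parity-split : ∀ {P : ℕ → Set} → (∀ t → P (0 + t * 2)) → (∀ t → P (1 + t * 2)) → ∀ n → P n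
parity-split {P} even odd n = subst P (sym (m≡m%n+[m/n]*n n 2)) (go (n % 2) (m%n<n n 2))
  where
  go : ∀ r → r < 2 → P (r + n / 2 * 2)
  go 0 _ = even (n / 2)
  go 1 _ = odd (n / 2)
  go (suc (suc _)) (s≤s (s≤s ()))

module _ (p D : ℕ) (steps : List Step) where

  excludesShift : ℕ → Bool
  excludesShift i = Sieve.excludes (shifted p D i) steps 0 ∧ Sieve.excludes (shifted p D i) steps 1

  -- The shift i = 1 is j = 0: for even m = y + 1 it is replaced by the two equations in m/2.
  certified : Bool
  certified =
    all excludesShift (0 ∷ 2 ∷ 3 ∷ 4 ∷ []) ∧
    Sieve.excludes (shifted p D 1) steps 0 ∧
    Sieve.excludes (halfEven p D) steps 0 ∧
    Sieve.excludes (halfOdd p D) steps 1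

  module _ (h : T certified) where
    private
      h₂ = proj₂ (to (T-∧ {all excludesShift (0 ∷ 2 ∷ 3 ∷ 4 ∷ [])}) h)
      h₃ = proj₂ (to (T-∧ {Sieve.excludes (shifted p D 1) steps 0}) h₂)

    shifted-unsolvable : ∀ {i} → i ∈ 0 ∷ 2 ∷ 3 ∷ 4 ∷ [] → ∀ x y z → ¬ L (x + y + i) ≡ F (suc y) * p ^ (D + z) + L x
    shifted-unsolvable {i} i∈ x y z = parity-split {λ y → ¬ L (x + y + i) ≡ F (suc y) * p ^ (D + z) + L x}
      (λ t → Sieve.excludes-sound (shifted p D i) steps 0 (proj₁ both) x t z ∘ shifted-holds p D i x (0 + t * 2) z)
      (λ t → Sieve.excludes-sound (shifted p D i) steps 1 (proj₂ both) x t z ∘ shifted-holds p D i x (1 + t * 2) z) y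
      where
      both = to (T-∧ {Sieve.excludes (shifted p D i) steps 0}) (lookup (all⁺ excludesShift _ (proj₁ (to T-∧ h))) i∈)

    shifted-1-unsolvable : ∀ k y z → ¬ L (suc k + y + 1) ≡ F (suc y) * p ^ (D + z) + L (suc k)
    shifted-1-unsolvable k y z = parity-split {λ y → ¬ L (suc k + y + 1) ≡ F (suc y) * p ^ (D + z) + L (suc k)}
      (λ t → Sieve.excludes-sound (shifted p D 1) steps 0 (proj₁ (to T-∧ h₂)) (suc k) t z ∘ shifted-holds p D 1 (suc k) (0 + t * 2) z)
      -- Now m = 2v with v = t + 1, so even `t` means odd v and `half-odd` comes first.
      (parity-split {λ t → ¬ L (suc k + (1 + t * 2) + 1) ≡ F (2 + t * 2) * p ^ (D + z) + L (suc k)} half-odd half-even) y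
      where
      open ≡-Reasoning
      B = p ^ (D + z)
      -- The parity of v decides which factor cancels afterwards: F v if v is even, L v if v is odd.
      factored : ∀ t {Δ} → L (suc t + (suc t + suc k)) ≡ L (suc k) + Δ →
                 L (suc k + (1 + t * 2) + 1) ≡ F (2 + t * 2) * B + L (suc k) → Δ ≡ F (suc t) * (L (suc t) * B)
      factored t {Δ} difference eq = +-cancelˡ-≡ (L (suc k)) _ _ (begin
        L (suc k) + Δ                              ≡⟨ difference ⟨
        L (suc t + (suc t + suc k))                ≡⟨ cong L (index t k) ⟩
        L (suc k + (1 + t * 2) + 1)                ≡⟨ eq ⟩
        F (2 + t * 2) * B + L (suc k)              ≡⟨ cong (λ n → F n * B + L (suc k)) (double t) ⟩
        F (suc t + suc t) * B + L (suc k)          ≡⟨ cong (λ s → s * B + L (suc k)) (Doubling.F-double t k) ⟩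
        F (suc t) * L (suc t) * B + L (suc k)      ≡⟨ reorder (F (suc t)) (L (suc t)) B (L (suc k)) ⟩
        L (suc k) + F (suc t) * (L (suc t) * B)    ∎)
        where
        index : ∀ t k → suc t + (suc t + suc k) ≡ suc k + (1 + t * 2) + 1
        index = solve-∀
        double : ∀ t → 2 + t * 2 ≡ suc t + suc t
        double = solve-∀
        reorder : ∀ a l b c → a * l * b + c ≡ c + a * (l * b)
        reorder = solve-∀
      half-even : ∀ s → ¬ L (suc k + (1 + (1 + s * 2) * 2) + 1) ≡ F (2 + (1 + s * 2) * 2) * B + L (suc k)
      half-even s eq = Sieve.excludes-sound (halfEven p D) steps 0 (proj₁ (to T-∧ h₃)) (suc k) (suc s) z
        (halfEven-holds p D (suc k) (suc s * 2) z (begin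
          5 * F (suc k + (2 + s * 2))   ≡⟨ cong (λ n → 5 * F n) (+-comm (suc k) (2 + s * 2)) ⟩
          5 * F (2 + s * 2 + suc k)     ≡⟨ cong (λ n → 5 * F n) (+-suc (2 + s * 2) k) ⟩
          5 * F (suc (2 + s * 2 + k))   ≡⟨ *-cancelˡ-≡ _ _ (F (2 + s * 2)) {{>-nonZero (F>0 (1 + s * 2))}}
                                             (factored (1 + s * 2) (Doubling.L-difference-even (1 + s * 2) k (cassini-even s)) eq) ⟩
          L (2 + s * 2) * B             ∎))
      half-odd : ∀ s → ¬ L (suc k + (1 + (0 + s * 2) * 2) + 1) ≡ F (2 + (0 + s * 2) * 2) * B + L (suc k)
      half-odd s eq = Sieve.excludes-sound (halfOdd p D) steps 1
        (proj₂ (to (T-∧ {Sieve.excludes (halfEven p D) steps 0}) h₃)) (suc k) s z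
        (halfOdd-holds p D (suc k) (1 + s * 2) z (begin
          L (suc k + (1 + s * 2))       ≡⟨ cong L (+-comm (suc k) (1 + s * 2)) ⟩
          L (1 + s * 2 + suc k)         ≡⟨ cong L (+-suc (1 + s * 2) k) ⟩
          L (suc (1 + s * 2 + k))       ≡⟨ *-cancelˡ-≡ _ _ (L (1 + s * 2)) {{>-nonZero (L>0 (1 + s * 2))}} (begin
            L (1 + s * 2) * L (suc (1 + s * 2 + k))
              ≡⟨ factored (s * 2) (Doubling.L-difference-odd (s * 2) k (cassini-odd s)) eq ⟩
            F (1 + s * 2) * (L (1 + s * 2) * B)
              ≡⟨ swap (F (1 + s * 2)) (L (1 + s * 2)) B ⟩
            L (1 + s * 2) * (F (1 + s * 2) * B) ∎) ⟩
          F (1 + s * 2) * B             ∎))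
        where
        swap : ∀ a l b → a * (l * b) ≡ l * (a * b)
        swap = solve-∀

-- Reduction to five shifts when k ≥ 5

L-mono : ∀ {n N} → n ≤ N → 2 ≤ N → L n ≤ L N
L-mono {n} {suc (suc N)} n≤N _ = go N n≤N
  where
  go : ∀ N → n ≤ 2 + N → L n ≤ L (2 + N)
  go zero    z≤n             = s≤s (s≤s z≤n)
  go zero    (s≤s z≤n)       = s≤s z≤n
  go zero    (s≤s (s≤s z≤n)) = ≤-refl
  go (suc N) n≤              with m≤n⇒m<n∨m≡n n≤
  ... | inj₂ refl      = ≤-refl
  ... | inj₁ (s≤s n≤N) = ≤-trans (go N n≤N) (m≤m+n (L (2 + N)) (L (1 + N)))
-- The bound 2 ≤ `N` keeps out L 1 < L 0, the only descent of the Lucas sequence.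
L-mono {N = 1} _ (s≤s ())

-- Both sides satisfy the Fibonacci recurrence in `y`, with equality at 1 and the hypothesis at 0.
L[y+k]≤ : ∀ {k} → L k ≤ L (suc k) → ∀ y → L (y + k) ≤ F (suc y) * L (suc k)
L[y+k]≤ {k} h 0             = ≤-trans h (≤-reflexive (sym (+-identityʳ (L (suc k)))))
L[y+k]≤ {k} h 1             = ≤-reflexive (sym (+-identityʳ (L (suc k))))
L[y+k]≤ {k} h (suc (suc y)) = ≤-trans (+-mono-≤ (L[y+k]≤ {k} h (suc y)) (L[y+k]≤ {k} h y))
  (≤-reflexive (sym (*-distribʳ-+ (L (suc k)) (F (2 + y)) (F (suc y)))))

-- This is j ≥ -1: a smaller `n` would give L n ≤ F m · L (5 + k) ≤ F m · B, which is less than L n.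
n≥k+y : ∀ {k y n B} → L (5 + k) < B → L n ≡ F (suc y) * B + L (5 + k) → 5 + k + y ≤ n
n≥k+y {k} {y} {n} {B} L<B eq with 5 + k + y ≤? n
... | yes le = le
... | no  nle = ⊥-elim (<-irrefl refl (begin-strict
  L n                             ≤⟨ L-mono (≤-pred (≰⇒> nle)) (s≤s (s≤s z≤n)) ⟩
  L (4 + k + y)                   ≡⟨ cong L (+-comm (4 + k) y) ⟩
  L (y + (4 + k))                 ≤⟨ L[y+k]≤ {4 + k} (m≤m+n (L (4 + k)) (L (3 + k))) y ⟩
  F (suc y) * L (5 + k)           ≤⟨ *-monoʳ-≤ (F (suc y)) (<⇒≤ L<B) ⟩
  F (suc y) * B                   <⟨ m<m+n _ (L>0 (5 + k)) ⟩
  F (suc y) * B + L (5 + k)       ≡⟨ eq ⟨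
  L n                             ∎))
  where open ≤-Reasoning

-- This is j ≤ 3. By `eq`, L n is at most 11 f X = f (33 a + 55 c), as X = 3 a + 5 c. Since F 9 = 34
-- and F 10 = 55, five more steps of the index reach at least f (34 a + 55 c); the surplus f a gives
-- strictness.
n<k+y+5 : ∀ {k y n B} → B ≤ 10 * L (5 + k) → L n ≡ F (suc y) * B + L (5 + k) → n < 5 + k + y + 5
n<k+y+5 {k} {y} {n} {B} B≤ eq with 5 + k + y + 5 ≤? n
... | no  nle = ≰⇒> nle
... | yes le = ⊥-elim (<-irrefl refl (begin-strict
  L n                                              ≡⟨ eq ⟩
  f * B + X                                        ≤⟨ +-mono-≤ (*-monoʳ-≤ f B≤) (m≤n*m X f {{>-nonZero (F>0 y)}}) ⟩
  f * (10 * X) + f * X                             <⟨ m<m+n _ fa>0 ⟩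
  f * (10 * X) + f * X + f * a                     ≤⟨ m≤m+n _ (21 * g * a + 34 * g * c) ⟩
  f * (10 * X) + f * X + f * a + (21 * g * a + 34 * g * c) ≡⟨ expand ⟩
  F (9 + y) * a + F (10 + y) * c                   ≡⟨ L-add (9 + y) k ⟨
  L (10 + y + k)                                   ≡⟨ cong L (index y k) ⟩
  L (5 + k + y + 5)                                ≤⟨ L-mono le (≤-trans (s≤s (s≤s z≤n)) le) ⟩
  L n                                              ∎))
  where
  open ≤-Reasoning
  f = F (suc y)
  g = F y
  a = L k
  c = L (suc k)
  X = L (5 + k)
  fa>0 : 0 < f * a
  fa>0 = *-mono-≤ (F>0 y) (L>0 k)
  index : ∀ y k → 10 + y + k ≡ 5 + k + y + 5
  index = solve-∀
  collect : ∀ f g a c →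
    f * (10 * (3 * a + 5 * c)) + f * (3 * a + 5 * c) + f * a + (21 * g * a + 34 * g * c) ≡
    (21 * g + 34 * f) * a + (34 * g + 55 * f) * c
  collect = solve-∀
  expand : f * (10 * X) + f * X + f * a + (21 * g * a + 34 * g * c) ≡ F (9 + y) * a + F (10 + y) * c
  expand = begin-equality
    f * (10 * X) + f * X + f * a + (21 * g * a + 34 * g * c)
      ≡⟨ cong (λ s → f * (10 * s) + f * s + f * a + (21 * g * a + 34 * g * c)) (L-add 4 k) ⟩
    f * (10 * (3 * a + 5 * c)) + f * (3 * a + 5 * c) + f * a + (21 * g * a + 34 * g * c)
      ≡⟨ collect f g a c ⟩
    (21 * g + 34 * f) * a + (34 * g + 55 * f) * c
      ≡⟨ cong₂ (λ s t → s * a + t * c) (F-add 8 y) (F-add 9 y) ⟨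
    F (9 + y) * a + F (10 + y) * c ∎

-- The two bounds leave the shifts i = j + 1 from 0 to 4, which the certificate excludes. The factor
-- 10 will come from b ≤ 10 and the lower digit bound on L k.
large-unsolvable : ∀ p D steps → T (certified p D steps) → ∀ {n k y z} →
                   L (5 + k) < p ^ (D + z) → p ^ (D + z) ≤ 10 * L (5 + k) →
                   ¬ L n ≡ F (suc y) * p ^ (D + z) + L (5 + k)
large-unsolvable p D steps h {n} {k} {y} {z} L<X X≤10L eq
  with i , refl ← m≤n⇒∃[o]m+o≡n (n≥k+y {k} {y} {n} L<X eq)
  = go i (+-cancelˡ-< (5 + k + y) i 5 (n<k+y+5 {k} {y} {5 + k + y + i} X≤10L eq)) eq
  where
  go : ∀ i → i < 5 → ¬ L (5 + k + y + i) ≡ F (suc y) * p ^ (D + z) + L (5 + k)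
  go 0 _ = shifted-unsolvable p D steps h (here refl) (5 + k) y z
  go 1 _ = shifted-1-unsolvable p D steps h (4 + k) y z
  go 2 _ = shifted-unsolvable p D steps h (there (here refl)) (5 + k) y z
  go 3 _ = shifted-unsolvable p D steps h (there (there (here refl))) (5 + k) y z
  go 4 _ = shifted-unsolvable p D steps h (there (there (there (here refl)))) (5 + k) y z
  go (suc (suc (suc (suc (suc _))))) (s≤s (s≤s (s≤s (s≤s (s≤s ())))))

-- The remaining values of d

G-mono : ∀ {a a′ c c′} n → a ≤ a′ → c ≤ c′ → G a c n ≤ G a′ c′ n
G-mono zero    a≤ c≤ = a≤
G-mono (suc n) a≤ c≤ = G-mono n c≤ (+-mono-≤ a≤ c≤)

G-gap : ∀ {a a′ c c′ δ} n → a + δ < a′ → c + δ < c′ → G a c n + δ < G a′ c′ n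
G-gap zero    a< c< = a<
G-gap {a} {a′} {c} {c′} {δ} (suc n) a< c< = G-gap n c< (begin-strict
  a + c + δ    ≡⟨ +-assoc a c δ ⟩
  a + (c + δ)  <⟨ +-mono-≤-< (≤-trans (m≤m+n a δ) (<⇒≤ a<)) c< ⟩
  a′ + c′      ∎)
  where open ≤-Reasoning

-- The difference of two Fibonacci-type sequences is again one, so once two consecutive terms have
-- both passed δ, or are both ≤ 0, the value δ is never taken again.
settled : (δ a c a′ c′ : ℕ) → Bool
settled δ a c a′ c′ = ((a ≤ᵇ a′) ∧ (c ≤ᵇ c′)) ∨ ((a′ + δ <ᵇ a) ∧ (c′ + δ <ᵇ c))

settled-sound : ∀ {δ a c a′ c′} → 0 < δ → T (settled δ a c a′ c′) → ∀ n → ¬ G a c n ≡ G a′ c′ n + δ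
settled-sound {δ} {a} {c} {a′} {c′} δ>0 h n eq with to (T-∨ {(a ≤ᵇ a′) ∧ (c ≤ᵇ c′)}) h
... | inj₁ below = let a≤ , c≤ = to (T-∧ {a ≤ᵇ a′}) below in
  <⇒≱ (m<m+n (G a′ c′ n) δ>0) (≤-trans (≤-reflexive (sym eq)) (G-mono n (≤ᵇ⇒≤ _ _ a≤) (≤ᵇ⇒≤ _ _ c≤)))
... | inj₂ above = let a< , c< = to (T-∧ {a′ + δ <ᵇ a}) above in
  <-irrefl (sym eq) (G-gap n (<ᵇ⇒< _ _ a<) (<ᵇ⇒< _ _ c<))

-- Walks along both sequences until they are settled, and `hit` has to accept each index where the
-- difference is δ. Running out of fuel counts as failure, so the amount of fuel is no assumption.
scan : (hit : ℕ → Bool) → (fuel y δ a c a′ c′ : ℕ) → Bool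
scan hit zero       y δ a c a′ c′ = false
scan hit (suc fuel) y δ a c a′ c′ =
  settled δ a c a′ c′ ∨ ((not (a ≡ᵇ a′ + δ) ∨ hit y) ∧ scan hit fuel (suc y) δ c (a + c) c′ (a′ + c′))

T-⇒ : ∀ {x y} → T (not x ∨ y) → T x → T y
T-⇒ {true} h _ = h

scan-sound : ∀ {hit} fuel y {δ a c a′ c′} → 0 < δ → T (scan hit fuel y δ a c a′ c′) →
             ∀ n → G a c n ≡ G a′ c′ n + δ → T (hit (n + y))
scan-sound {hit} (suc fuel) y {δ} {a} {c} {a′} {c′} δ>0 h n eq with to (T-∨ {settled δ a c a′ c′}) h
... | inj₁ s = ⊥-elim (settled-sound {δ} {a} {c} {a′} {c′} δ>0 s n eq)
... | inj₂ h′ with to (T-∧ {not (a ≡ᵇ a′ + δ) ∨ hit y}) h′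
... | now , later with n
... | zero   = T-⇒ now (≡⇒≡ᵇ a (a′ + δ) eq)
... | suc n′ = subst (T ∘ hit) (+-suc n′ y) (scan-sound {hit} fuel (suc y) δ>0 later n′ eq)

open DecMembership (≡-dec _≟_ (≡-dec _≟_ (≡-dec _≟_ (≡-dec _≟_ _≟_)))) using (_∈?_)

listed : (b e k i y : ℕ) → Bool
listed b e k i y = ⌊ (y + i , suc y , k , b , suc e) ∈? solutions ⌋

hasDigits : (b e N : ℕ) → Bool
hasDigits b e N = (b ^ e ≤ᵇ N) ∧ (N <ᵇ b ^ suc e)

-- Compares L (y + i) with F (y + 1) · b ^ (e + 1) as sequences in y; the factors 1 are F 1 and F 2.
scanFrom : (b e k i : ℕ) → Bool
scanFrom b e k i = scan (listed b e k i) 20 0 (L k) (L i) (L (suc i)) (1 * b ^ suc e) (1 * b ^ suc e)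

digitCase : (b e k : ℕ) → Bool
digitCase b e k = not (hasDigits b e (L k)) ∨ all (scanFrom b e k) (upTo 13)

exponentCase : (b e : ℕ) → Bool
exponentCase b e = all (digitCase b e) (upTo 9)

baseCase : ℕ → Bool
baseCase b = all (exponentCase b) (upTo 6)

-- The ranges are b ≤ 10, e < τ ≤ 6, k ≤ 8 and n - y ≤ 12. Bases 0 and 1 pass vacuously, as no L k
-- has digits there.
smallCases : Bool
smallCases = all baseCase (upTo 11)

smallCases-hold : smallCases ≡ true
smallCases-hold = refl

small-listed : ∀ {b e k i y} → b < 11 → e < 6 → k < 9 → i < 13 → b ^ e ≤ L k → L k < b ^ suc e →
               L (y + i) ≡ F (suc y) * b ^ suc e + L k → (y + i , suc y , k , b , suc e) ∈ solutions
small-listed {b} {e} {k} {i} {y} b< e< k< i< lo hi eq = toWitness (subst (T ∘ listed b e k i) (+-identityʳ y)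
  (scan-sound {listed b e k i} 20 0 (L>0 k) scanned y (begin
    G (L i) (L (suc i)) y                            ≡⟨ Recurrent⇒G (λ n → L (n + i)) (λ _ → refl) y ⟨
    L (y + i)                                        ≡⟨ eq ⟩
    F (suc y) * b ^ suc e + L k                      ≡⟨ cong (_+ L k) (Recurrent⇒G (λ n → F (suc n) * b ^ suc e)
                                                          (λ n → *-distribʳ-+ (b ^ suc e) (F (2 + n)) (F (1 + n))) y) ⟩
    G (1 * b ^ suc e) (1 * b ^ suc e) y + L k        ∎)))
  where
  open ≡-Reasoning
  digitsᵇ : T (hasDigits b e (L k))
  digitsᵇ = from T-∧ (≤⇒≤ᵇ lo , <⇒<ᵇ hi)
  scanned : T (scanFrom b e k i)
  scanned = T-all-upTo {scanFrom b e k} (T-⇒ {hasDigits b e (L k)}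
    (T-all-upTo {digitCase b e} (T-all-upTo {exponentCase b} (T-all-upTo {baseCase} {11} (from T-≡ smallCases-hold) b<) e<) k<)
    digitsᵇ) i<

-- Bounds on n for small k

F-mono : ∀ o n → F (suc n) ≤ F (suc (o + n))
F-mono zero    n = ≤-refl
F-mono (suc o) n = ≤-trans (F-mono o n) (m≤m+n (F (suc (o + n))) (F (o + n)))

L≤2F : ∀ n → L n ≤ 2 * F (suc n)
L≤2F 0             = ≤-refl
L≤2F 1             = s≤s z≤n
L≤2F (suc (suc n)) = ≤-trans (+-mono-≤ (L≤2F (suc n)) (L≤2F n))
                             (≤-reflexive (sym (*-distribˡ-+ 2 (F (2 + n)) (F (suc n)))))

-- Since B > L k ≥ 1, B is at least 2; thus n < y would give L n ≤ 2 F (n + 1) ≤ F (y + 1) · B,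
-- which is less than L n.
n≥y : ∀ {n y k B} → L k < B → L n ≡ F (suc y) * B + L k → y ≤ n
n≥y {n} {y} {k} {B} L<B eq with y ≤? n
... | yes le = le
... | no nle with o , refl ← m≤n⇒∃[o]m+o≡n (<⇒≤ (≰⇒> nle)) = ⊥-elim (<-irrefl refl (begin-strict
  L n                      ≤⟨ L≤2F n ⟩
  2 * F (suc n)            ≤⟨ *-monoʳ-≤ 2 (F-mono o n) ⟩
  2 * F (suc (o + n))      ≡⟨ cong (λ s → 2 * F (suc s)) (+-comm o n) ⟩
  2 * F (suc (n + o))      ≡⟨ *-comm 2 (F (suc (n + o))) ⟩
  F (suc (n + o)) * 2      ≤⟨ *-monoʳ-≤ (F (suc (n + o))) (≤-trans (s≤s (L>0 k)) L<B) ⟩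
  F (suc (n + o)) * B      <⟨ m<m+n _ (L>0 k) ⟩
  F (suc (n + o)) * B + L k ≡⟨ eq ⟨
  L n                      ∎))
  where open ≤-Reasoning

-- From L k ≤ L 8 = 47 the right-hand side is at most 11 · 47 = 517 times F (y + 1), and 13 is the
-- first index with a Lucas number above that, L 13 = 521.
n<y+13 : ∀ {n y k B} → k ≤ 8 → B ≤ 10 * L k → L n ≡ F (suc y) * B + L k → n < y + 13
n<y+13 {n} {y} {k} {B} k≤8 B≤ eq with y + 13 ≤? n
... | no nle = ≰⇒> nle
... | yes le = ⊥-elim (<-irrefl refl (begin-strict
  L n                             ≡⟨ eq ⟩
  f * B + L k                     ≤⟨ +-mono-≤ (*-monoʳ-≤ f (≤-trans B≤ (*-monoʳ-≤ 10 Lk≤47))) (≤-trans Lk≤47 (m≤n*m 47 f)) ⟩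
  f * 470 + f * 47                ≡⟨ *-distribˡ-+ f 470 47 ⟨
  f * 517                         <⟨ *-monoʳ-< f (<ᵇ⇒< 517 521 tt) ⟩
  f * 521                         ≤⟨ m≤n+m (f * 521) (F y * 322) ⟩
  F y * 322 + f * 521             ≡⟨ L-add y 12 ⟨
  L (suc y + 12)                  ≡⟨ cong L (+-suc y 12) ⟨
  L (y + 13)                      ≤⟨ L-mono le (≤-trans (≤-trans (s≤s (s≤s z≤n)) (m≤n+m 13 y)) le) ⟩
  L n                             ∎))
  where
  open ≤-Reasoning
  f = F (suc y)
  instance
    f≢0 : NonZero f
    f≢0 = >-nonZero (F>0 y)
  Lk≤47 : L k ≤ 47
  Lk≤47 = L-mono k≤8 (s≤s (s≤s z≤n))

-- The listed tuples are solutions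

solution? : Tuple → Bool
solution? (n , m , k , b , zero)  = false
solution? (n , m , k , b , suc e) = hasDigits b e (L k) ∧ (L n ≡ᵇ F m * b ^ suc e + L k)

solutions-hold : all solution? solutions ≡ true
solutions-hold = refl

solution?-sound : ∀ n m k b d → T (solution? (n , m , k , b , d)) → NumDigits b (L k) d × L n ≡ F m * b ^ d + L k
solution?-sound n m k b (suc e) h =
  let ds , eq = to (T-∧ {hasDigits b e (L k)}) h
      lo , hi = to (T-∧ {b ^ e ≤ᵇ L k}) ds
  in digits e (≤ᵇ⇒≤ (b ^ e) (L k) lo) (<ᵇ⇒< (L k) (b ^ suc e) hi) , ≡ᵇ⇒≡ (L n) (F m * b ^ suc e + L k) eq

listed⇒solution : ∀ {n m k b d} → (n , m , k , b , d) ∈ solutions → NumDigits b (L k) d × L n ≡ F m * b ^ d + L k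
listed⇒solution {n} {m} {k} {b} {d} ∈s =
  solution?-sound n m k b d (lookup (all⁺ solution? solutions (from T-≡ solutions-hold)) ∈s)

-- τ separates the cases: for d ≤ τ the bound L k < b ^ τ ≤ L 9 leaves finitely many k, and for
-- d = suc τ + z the bound 8 ≤ b ^ τ ≤ L k gives 5 ≤ k and b ^ d is a power of p accessible to the sieve.
record Certificate (b : ℕ) : Set where
  field
    p D τ     : ℕ
    steps     : List Step
    certify   : certified p D steps ≡ true
    power     : ∀ z → ∃ λ z′ → b ^ (suc τ + z) ≡ p ^ (D + z′)
    τ≤6       : τ ≤ 6
    8≤bᵗ      : 8 ≤ b ^ τ
    bᵗ≤76     : b ^ τ ≤ 76

solution⇒listed : ∀ {b} → 2 ≤ b → b ≤ 10 → Certificate b → ∀ {n y k d} →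
                  NumDigits b (L k) d → L n ≡ F (suc y) * b ^ d + L k → (n , suc y , k , b , d) ∈ solutions
solution⇒listed {b} 2≤b b≤10 cert {n} {y} {k} (digits e lo hi) eq with Certificate.τ cert ≤? e
... | no e≱τ with i , refl ← m≤n⇒∃[o]m+o≡n (n≥y {n} {y} {k} hi eq) =
  small-listed (s≤s b≤10) (<-≤-trans e<τ τ≤6) (s≤s k≤8) (+-cancelˡ-< y i 13 (n<y+13 {y + i} {y} {k} k≤8 B≤ eq)) lo hi eq
  where
  open Certificate cert
  instance
    b≢0 : NonZero b
    b≢0 = >-nonZero (≤-trans (s≤s z≤n) 2≤b)
  e<τ : e < τ
  e<τ = ≰⇒> e≱τ
  k≤8 : k ≤ 8
  k≤8 with k ≤? 8
  ... | yes le = le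
  ... | no nle = ⊥-elim (<-irrefl refl (begin-strict
    L k        <⟨ hi ⟩
    b ^ suc e  ≤⟨ ^-monoʳ-≤ b e<τ ⟩
    b ^ τ      ≤⟨ bᵗ≤76 ⟩
    L 9        ≤⟨ L-mono (≰⇒> nle) (≤-trans (s≤s (s≤s z≤n)) (≰⇒> nle)) ⟩
    L k        ∎))
    where open ≤-Reasoning
  B≤ : b ^ suc e ≤ 10 * L k
  B≤ = *-mono-≤ b≤10 lo
... | yes τ≤e with z , refl ← m≤n⇒∃[o]m+o≡n τ≤e = ⊥-elim absurd
  where
  open Certificate cert
  instance
    b≢0 : NonZero b
    b≢0 = >-nonZero (≤-trans (s≤s z≤n) 2≤b)
  5≤k : 5 ≤ k
  5≤k with 5 ≤? k
  ... | yes le = le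
  ... | no nle = ⊥-elim (<-irrefl refl (begin-strict
    L k          ≤⟨ L-mono {k} {4} (≤-pred (≰⇒> nle)) (s≤s (s≤s z≤n)) ⟩
    -- 7 is L 4, the largest Lucas number of index below 5.
    7            <⟨ 8≤bᵗ ⟩
    b ^ τ        ≤⟨ ^-monoʳ-≤ b (m≤m+n τ z) ⟩
    b ^ (τ + z)  ≤⟨ lo ⟩
    L k          ∎))
    where open ≤-Reasoning
  absurd : ⊥
  absurd with k′ , refl ← m≤n⇒∃[o]m+o≡n 5≤k | z′ , X≡ ← power z =
    large-unsolvable p D steps (from T-≡ certify) {n} {k′} {y} {z′}
      (subst (L (5 + k′) <_) X≡ hi) (subst (_≤ 10 * L (5 + k′)) X≡ (*-mono-≤ b≤10 lo))
      (subst (λ X → L n ≡ F (suc y) * X + L (5 + k′)) X≡ eq)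

-- Certificates, found by a greedy computer search

-- Serves the bases 2, 4 and 8, just as `steps₃` serves 3 and 9. In each list `D` is large enough
-- for `p ^ D` to vanish modulo the powers of primes dividing `p`, whence their order 1.
steps₂ : List Step
steps₂ =
  step 4 6 1 3 1 ∷ step 8 12 1 2 1 ∷ step 16 24 1 2 1 ∷ step 3 8 2 1 2 ∷ step 32 48 1 2 1 ∷
  step 7 16 3 1 3 ∷ step 64 96 1 2 1 ∷ step 128 192 1 2 1 ∷ step 19 18 18 3 3 ∷ step 17 36 8 1 4 ∷
  step 5 20 4 5 1 ∷ step 241 240 24 1 1 ∷ step 61 60 60 1 5 ∷ step 769 192 384 1 16 ∷
  step 641 640 64 2 1 ∷ []

certified₂ : certified 2 7 steps₂ ≡ true
certified₂ = refl

steps₃ : List Step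
steps₃ =
  step 11 10 5 5 5 ∷ step 5 20 4 2 4 ∷ step 61 60 10 3 1 ∷ step 41 40 8 2 2 ∷ step 31 30 30 1 3 ∷
  step 27 72 1 3 1 ∷ step 181 90 45 1 3 ∷ step 541 90 135 1 3 ∷ step 271 270 30 3 1 ∷
  step 81 216 1 1 1 ∷ []

certified₃ : certified 3 4 steps₃ ≡ true
certified₃ = refl

steps₅ : List Step
steps₅ =
  step 3 8 2 4 2 ∷ step 5 20 1 5 1 ∷ step 11 10 5 1 5 ∷ step 41 40 20 1 2 ∷ step 25 100 1 5 1 ∷
  step 101 50 25 1 5 ∷ step 401 200 25 1 1 ∷ step 3001 100 250 1 5 ∷ step 251 250 25 5 1 ∷
  step 125 500 1 1 1 ∷ []

certified₅ : certified 5 3 steps₅ ≡ true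
certified₅ = refl

steps₆ : List Step
steps₆ =
  step 4 6 1 3 1 ∷ step 8 12 1 2 1 ∷ step 9 24 1 2 1 ∷ step 7 16 2 2 2 ∷ step 27 72 1 3 1 ∷
  step 19 18 9 1 9 ∷ step 541 90 36 5 2 ∷ step 2161 80 45 1 5 ∷ []

certified₆ : certified 6 3 steps₆ ≡ true
certified₆ = refl

steps₇ : List Step
steps₇ =
  step 3 8 1 4 1 ∷ step 7 16 1 2 1 ∷ step 49 112 1 7 1 ∷ step 29 14 7 1 7 ∷ step 281 56 20 1 20 ∷
  step 421 84 70 3 1 ∷ step 911 70 14 5 1 ∷ step 211 42 210 1 3 ∷ step 241 240 240 1 4 ∷ []

certified₇ : certified 7 2 steps₇ ≡ true
certified₇ = refl

steps₁₀ : List Step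
steps₁₀ =
  step 11 10 2 5 2 ∷ step 5 20 1 2 1 ∷ step 3 8 1 2 1 ∷ step 41 40 5 1 5 ∷ step 31 30 15 3 3 ∷
  step 61 60 60 1 2 ∷ step 4 6 1 1 1 ∷ []

certified₁₀ : certified 10 2 steps₁₀ ≡ true
certified₁₀ = refl

-- `τ` is least such that `p ^ D` divides `b ^ suc τ` and `8 ≤ b ^ τ`. Only for b = 7 is the second
-- condition decisive, as 7 < 8; hence the spare factor in `power` there.
certificate : ∀ {b} → 2 ≤ b → b ≤ 10 → Certificate b
certificate {0} () _
certificate {1} (s≤s ()) _
certificate {2} _ _ = record
  { p = 2 ; D = 7 ; τ = 6 ; steps = steps₂ ; certify = certified₂
  ; power = λ z → z , refl
  ; τ≤6 = ≤ᵇ⇒≤ 6 6 tt ; 8≤bᵗ = ≤ᵇ⇒≤ 8 (2 ^ 6) tt ; bᵗ≤76 = ≤ᵇ⇒≤ (2 ^ 6) 76 tt }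
certificate {3} _ _ = record
  { p = 3 ; D = 4 ; τ = 3 ; steps = steps₃ ; certify = certified₃
  ; power = λ z → z , refl
  ; τ≤6 = ≤ᵇ⇒≤ 3 6 tt ; 8≤bᵗ = ≤ᵇ⇒≤ 8 (3 ^ 3) tt ; bᵗ≤76 = ≤ᵇ⇒≤ (3 ^ 3) 76 tt }
certificate {4} _ _ = record
  { p = 2 ; D = 7 ; τ = 3 ; steps = steps₂ ; certify = certified₂
  ; power = λ z → 1 + 2 * z , trans (^-*-assoc 2 2 (4 + z)) (cong (2 ^_) (rearrange z))
  ; τ≤6 = ≤ᵇ⇒≤ 3 6 tt ; 8≤bᵗ = ≤ᵇ⇒≤ 8 (4 ^ 3) tt ; bᵗ≤76 = ≤ᵇ⇒≤ (4 ^ 3) 76 tt }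
  where
  rearrange : ∀ z → 2 * (4 + z) ≡ 7 + (1 + 2 * z)
  rearrange = solve-∀
certificate {5} _ _ = record
  { p = 5 ; D = 3 ; τ = 2 ; steps = steps₅ ; certify = certified₅
  ; power = λ z → z , refl
  ; τ≤6 = ≤ᵇ⇒≤ 2 6 tt ; 8≤bᵗ = ≤ᵇ⇒≤ 8 (5 ^ 2) tt ; bᵗ≤76 = ≤ᵇ⇒≤ (5 ^ 2) 76 tt }
certificate {6} _ _ = record
  { p = 6 ; D = 3 ; τ = 2 ; steps = steps₆ ; certify = certified₆
  ; power = λ z → z , refl
  ; τ≤6 = ≤ᵇ⇒≤ 2 6 tt ; 8≤bᵗ = ≤ᵇ⇒≤ 8 (6 ^ 2) tt ; bᵗ≤76 = ≤ᵇ⇒≤ (6 ^ 2) 76 tt }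
certificate {7} _ _ = record
  { p = 7 ; D = 2 ; τ = 2 ; steps = steps₇ ; certify = certified₇
  ; power = λ z → suc z , refl
  ; τ≤6 = ≤ᵇ⇒≤ 2 6 tt ; 8≤bᵗ = ≤ᵇ⇒≤ 8 (7 ^ 2) tt ; bᵗ≤76 = ≤ᵇ⇒≤ (7 ^ 2) 76 tt }
certificate {8} _ _ = record
  { p = 2 ; D = 7 ; τ = 2 ; steps = steps₂ ; certify = certified₂
  ; power = λ z → 2 + 3 * z , trans (^-*-assoc 2 3 (3 + z)) (cong (2 ^_) (rearrange z))
  ; τ≤6 = ≤ᵇ⇒≤ 2 6 tt ; 8≤bᵗ = ≤ᵇ⇒≤ 8 (8 ^ 2) tt ; bᵗ≤76 = ≤ᵇ⇒≤ (8 ^ 2) 76 tt }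
  where
  rearrange : ∀ z → 3 * (3 + z) ≡ 7 + (2 + 3 * z)
  rearrange = solve-∀
certificate {9} _ _ = record
  { p = 3 ; D = 4 ; τ = 1 ; steps = steps₃ ; certify = certified₃
  ; power = λ z → 2 * z , trans (^-*-assoc 3 2 (2 + z)) (cong (3 ^_) (rearrange z))
  ; τ≤6 = ≤ᵇ⇒≤ 1 6 tt ; 8≤bᵗ = ≤ᵇ⇒≤ 8 (9 ^ 1) tt ; bᵗ≤76 = ≤ᵇ⇒≤ (9 ^ 1) 76 tt }
  where
  rearrange : ∀ z → 2 * (2 + z) ≡ 4 + 2 * z
  rearrange = solve-∀
certificate {10} _ _ = record
  { p = 10 ; D = 2 ; τ = 1 ; steps = steps₁₀ ; certify = certified₁₀
  ; power = λ z → z , refl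
  ; τ≤6 = ≤ᵇ⇒≤ 1 6 tt ; 8≤bᵗ = ≤ᵇ⇒≤ 8 (10 ^ 1) tt ; bᵗ≤76 = ≤ᵇ⇒≤ (10 ^ 1) 76 tt }
certificate {suc (suc (suc (suc (suc (suc (suc (suc (suc (suc (suc b))))))))))} _ b≤10 = ⊥-elim (<⇒≱ (m≤m+n 11 b) b≤10)

theorem1p2 : (b : ℕ) → 2 ≤ b → b ≤ 10 → (n m k d : ℕ) → 1 ≤ m →
    ((NumDigits b (L k) d × L n ≡ F m * b ^ d + L k) ⇔ ((n , m , k , b , d) ∈ solutions))
theorem1p2 b 2≤b b≤10 n (suc y) k d _ = mk⇔
  (λ (ds , eq) → solution⇒listed 2≤b b≤10 (certificate 2≤b b≤10) ds eq)
  listed⇒solution
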